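{- Let $p>2$ be a prime and $a\in\mathbb{Z}$. Then $U^3\vdash^M_\gamma\Psi$, where $\Psi$ is the linear datum with index set $[4]$, $V=\mathbb{F}_p^4$, $W_1=W_2=\mathbb{F}_p$, $W_3=W_4=\mathbb{F}_p^3$, $\phi_1(x,y,z,w)=x+az+w$, $\phi_2(x,y,z,w)=y+z+aw$, $\phi_3(x,y,z,w)=(x,y,w)$, $\phi_4(x,y,z,w)=(x,y,z)$; $M=6+\lfloor\log_2\lfloor\log_2(|a|-1)\rfloor\rfloor$ if $|a|\ge4$ and $M=5$ if $|a|<4$; and $\gamma(1)=(000,0)$, $\gamma(2)=(000,1)$ (and $\gamma$ undefined at $3,4$).
   Context: A linear datum $(I,V,(W_\ell),(\phi_\ell))$: finite index set, finite-dimensional $\mathbb{F}_p$-spaces, linear maps $\phi_\ell\colon V\to W_\ell$. $U^3$ is the datum with index set $\{0,1\}^3$, $V=\mathbb{F}_p^4$, $W_\omega=\mathbb{F}_p$, $\phi_\omega(x,h_1,h_2,h_3)=x+\omega_1h_1+\omega_2h_2+\omega_3h_3$. Morphisms: with $W_*=\{0\}$, $\phi_*=0$, a morphism $\Psi'\to\Phi$ of shape $\alpha\colon I^\Phi\to I^{\Psi'}\cup\{*\}$ is a linear $\theta\colon V^{\Psi'}\to V^\Phi$ with linear $\sigma_j\colon W^{\Psi'}_{\alpha(j)}\to W^\Phi_j$ such that $\sigma_j\circ\phi^{\Psi'}_{\alpha(j)}=\phi^\Phi_j\circ\theta$; it respects $j$ if $\alpha(j)\ne*$, $j$ is the only index mapped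 to $\alpha(j)$, $W^\Phi_j=W^{\Psi'}_{\alpha(j)}$ and $\sigma_j=\mathrm{id}$. Self-joining $\Phi+_S\Phi$ ($S\subseteq I^\Phi$): indices $(L,i),(R,i)$ for $i\notin S$, space $\{(v_0,v_1)\in V\oplus V:\phi_i(v_0)=\phi_i(v_1)\,\forall i\in S\}$, maps $\phi_i(v_0)$, $\phi_i(v_1)$. For a partial $\gamma\colon I^{\Psi'}\to I^\Phi\times\{0,1\}$, $\Phi\vdash^k_\gamma\Psi'$ holds if: (a) a morphism $\Theta\colon\Psi'\to\Phi$ exists, $k=0$, $\gamma=\{\alpha^\Theta(i)\mapsto(i,0):\Theta\text{ respects }i\}$; or (b) $\Psi'=\Phi+_S\Phi$, $\gamma(L,i)=(i,0)$, $\gamma(R,i)=(i,1)$ for $i\notin S$; or (c) $\Phi\vdash^{k_1}_{\gamma_1}\Xi$ and $\Xi\vdash^{k_2}_{\gamma_2}\Psi'$ with $k=k_1+k_2$ and $\gamma(j)=(i,a_1+a_2\bmod2)$ whenever $\gamma_2(j)=(\ell,a_2)$, $\gamma_1(\ell)=(i,a_1)$; or (d) $\Phi\vdash^{k'}_{\gamma'}\Psi'$ with $k'\le k$ and $\gamma$ a restriction of $\gamma'$. -}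

module Defs where

open import Data.Nat as ℕ using (ℕ; zero; suc; _≤_; _≤?_; _∸_; NonZero)
open import Data.Nat.DivMod using (_mod_)
open import Data.Nat.Logarithm using (⌊log₂_⌋)
open import Data.Integer as ℤ using (ℤ; ∣_∣)
open import Data.Integer.DivMod using (_%ℕ_)
open import Data.Fin using (Fin; zero; suc; toℕ; splitAt)
open import Data.Bool using (Bool; true; false; _xor_)
open import Data.Maybe using (Maybe; just; nothing; _>>=_)
open import Data.Product using (Σ; _×_; _,_; ∃)
open import Data.Sum using (_⊎_; inj₁; inj₂; [_,_]′)
open import Data.Empty using (⊥)
open import Relation.Nullary using (yes; no)
open import Relation.Binary.PropositionalEquality using (_≡_; subst)

-- A partial map  γ : I^Ψ' ⇀ I^Φ × {0,1}  (Bool: false = 0, true = 1).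
PMap : Set → Set → Set
PMap I' I = I' → Maybe (I × Bool)

Restriction : {I' I : Set} → PMap I' I → PMap I' I → Set
Restriction γ γ' = ∀ j x → γ j ≡ just x → γ' j ≡ just x

composeγ : {I J K : Set} → PMap J I → PMap K J → PMap K I
composeγ γ₁ γ₂ j = γ₂ j >>= λ { (ℓ , a₂) → γ₁ ℓ >>= λ { (i , a₁) → just (i , a₁ xor a₂) } }

Mbound : ℤ → ℕ
Mbound a with 4 ≤? ∣ a ∣
... | yes _ = 6 ℕ.+ ⌊log₂ ⌊log₂ (∣ a ∣ ∸ 1) ⌋ ⌋
... | no _  = 5

Cube : Set
Cube = Bool × Bool × Bool

-- γ(1) = (000,0), γ(2) = (000,1), undefined at 3, 4.
-- (The paper's index set [4] = {1,2,3,4} is Fin 4 with k ↦ k-1.)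
γΨ : PMap (Fin 4) Cube
γΨ zero                   = just ((false , false , false) , false)
γΨ (suc zero)             = just ((false , false , false) , true)
γΨ (suc (suc zero))       = nothing
γΨ (suc (suc (suc zero))) = nothing

module _ (p : ℕ) .{{_ : NonZero p}} where

  F : Set
  F = Fin p

  0F 1F : F
  0F = 0 mod p
  1F = 1 mod p

  _+F_ _*F_ : F → F → F
  x +F y = (toℕ x ℕ.+ toℕ y) mod p
  x *F y = (toℕ x ℕ.* toℕ y) mod p

  -F_ : F → F
  -F x = (p ∸ toℕ x) mod p

  ⟦_⟧ℤ : ℤ → F
  ⟦ a ⟧ℤ = (a %ℕ p) mod p

  bit : Bool → F
  bit false = 0F
  bit true  = 1F

  FV : ℕ → Set
  FV n = Fin n → F

  Mat : ℕ → ℕ → Set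
  Mat m n = Fin m → Fin n → F

  sumF : ∀ {n} → (Fin n → F) → F
  sumF {zero}  f = 0F
  sumF {suc n} f = f zero +F sumF (λ j → f (suc j))

  _·_ : ∀ {m n} → Mat m n → FV n → FV m
  (A · v) i = sumF (λ j → A i j *F v j)

  _≈_ : ∀ {n} → FV n → FV n → Set
  u ≈ v = ∀ i → u i ≡ v i

  -- A linear datum (I, V, (W_ℓ), (φ_ℓ)).
  -- V is a subspace of F_p^dim, presented as the common kernel of a
  -- family of linear functionals (rows) indexed by Cons;
  -- W_ℓ = F_p^(wdim ℓ); φ_ℓ is given by a matrix on F_p^dim and is
  -- only ever used restricted to V.
  record LinDatum : Set₁ where
    field
      Idx  : Set
      dim  : ℕ
      Cons : Set
      con  : Cons → FV dim
      wdim : Idx → ℕ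
      φ    : (i : Idx) → Mat (wdim i) dim

    InV : FV dim → Set
    InV v = ∀ c → sumF (λ j → con c j *F v j) ≡ 0F

  open LinDatum public

  FiniteIdx : LinDatum → Set
  FiniteIdx Ψ = Σ ℕ λ n → Σ (Fin n → Idx Ψ) λ f → ∀ i → ∃ λ m → f m ≡ i

  -- extension by the dummy index * with W_* = {0}, φ_* = 0
  extW : (Ψ : LinDatum) → Maybe (Idx Ψ) → ℕ
  extW Ψ nothing  = 0
  extW Ψ (just k) = wdim Ψ k

  extφ : (Ψ : LinDatum) (m : Maybe (Idx Ψ)) → Mat (extW Ψ m) (dim Ψ)
  extφ Ψ nothing  = λ ()
  extφ Ψ (just k) = φ Ψ k

  record Morphism (Ψ' Φ : LinDatum) : Set where
    field
      α    : Idx Φ → Maybe (Idx Ψ')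
      θ    : Mat (dim Φ) (dim Ψ')
      θ-V  : ∀ v → InV Ψ' v → InV Φ (θ · v)
      σ    : (j : Idx Φ) → Mat (wdim Φ j) (extW Ψ' (α j))
      comm : ∀ j v → InV Ψ' v → (σ j · (extφ Ψ' (α j) · v)) ≈ (φ Φ j · (θ · v))

  open Morphism public

  Respects : {Ψ' Φ : LinDatum} → Morphism Ψ' Φ → Idx Φ → Set
  Respects {Ψ'} {Φ} Θ j =
    Σ (Idx Ψ') λ k → (α Θ j ≡ just k)
      × (∀ j' → α Θ j' ≡ just k → j' ≡ j)
      × Σ (extW Ψ' (α Θ j) ≡ wdim Φ j) λ e → ∀ w → (σ Θ j · w) ≈ subst FV e w

  RespectMap : {Ψ' Φ : LinDatum} → Morphism Ψ' Φ → PMap (Idx Ψ') (Idx Φ) → Set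
  RespectMap {Ψ'} {Φ} Θ γ = ∀ (k : Idx Ψ') →
      (∀ i b → γ k ≡ just (i , b) → (b ≡ false) × Respects Θ i × (α Θ i ≡ just k))
    × (∀ i → Respects Θ i → α Θ i ≡ just k → γ k ≡ just (i , false))

  -- Self-joining Φ +_S Φ  (S ⊆ I^Φ as a Boolean predicate;
  -- side false = L, true = R).
  selfJoin : (Φ : LinDatum) → (Idx Φ → Bool) → LinDatum
  selfJoin Φ S = record
    { Idx  = Bool × Σ (Idx Φ) (λ i → S i ≡ false)
    ; dim  = dim Φ ℕ.+ dim Φ
    ; Cons = Cons Φ ⊎ (Cons Φ ⊎ Σ (Idx Φ) (λ i → (S i ≡ true) × Fin (wdim Φ i)))
    ; con  = row
    ; wdim = λ { (_ , i , _) → wdim Φ i }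
    ; φ    = λ { (false , i , _) r j → [ φ Φ i r , (λ _ → 0F) ]′ (splitAt (dim Φ) j)
               ; (true  , i , _) r j → [ (λ _ → 0F) , φ Φ i r ]′ (splitAt (dim Φ) j) }
    }
    where
    row : Cons Φ ⊎ (Cons Φ ⊎ Σ (Idx Φ) (λ i → (S i ≡ true) × Fin (wdim Φ i))) → FV (dim Φ ℕ.+ dim Φ)
    -- v₀ ∈ V
    row (inj₁ c) j = [ con Φ c , (λ _ → 0F) ]′ (splitAt (dim Φ) j)
    -- v₁ ∈ V
    row (inj₂ (inj₁ c)) j = [ (λ _ → 0F) , con Φ c ]′ (splitAt (dim Φ) j)
    -- (φ_i v₀)_r - (φ_i v₁)_r = 0 for i ∈ S
    row (inj₂ (inj₂ (i , _ , r))) j =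
      [ φ Φ i r , (λ k → -F (φ Φ i r k)) ]′ (splitAt (dim Φ) j)

  joinγ : (Φ : LinDatum) (S : Idx Φ → Bool) → PMap (Idx (selfJoin Φ S)) (Idx Φ)
  joinγ Φ S (b , i , _) = just (i , b)

  data Derives : (Φ : LinDatum) → ℕ → (Ψ' : LinDatum) → PMap (Idx Ψ') (Idx Φ) → Set₁ where
    morph  : ∀ {Φ Ψ'} (Θ : Morphism Ψ' Φ) → FiniteIdx Ψ' →
             (γ : PMap (Idx Ψ') (Idx Φ)) → RespectMap Θ γ → Derives Φ 0 Ψ' γ
    join   : ∀ {Φ} (S : Idx Φ → Bool) → Derives Φ 1 (selfJoin Φ S) (joinγ Φ S)
    trans  : ∀ {Φ Ξ Ψ' k₁ k₂ γ₁ γ₂} → Derives Φ k₁ Ξ γ₁ → Derives Ξ k₂ Ψ' γ₂ →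
             Derives Φ (k₁ ℕ.+ k₂) Ψ' (composeγ γ₁ γ₂)
    weaken : ∀ {Φ Ψ' k k' γ γ'} → k' ≤ k → Restriction γ γ' →
             Derives Φ k' Ψ' γ' → Derives Φ k Ψ' γ

  U3 : LinDatum
  U3 = record
    { Idx  = Cube
    ; dim  = 4
    ; Cons = ⊥
    ; con  = λ ()
    ; wdim = λ _ → 1
    ; φ    = λ { (ω₁ , ω₂ , ω₃) _ → coeffs ω₁ ω₂ ω₃ }
    }
    where
    coeffs : Bool → Bool → Bool → FV 4
    coeffs ω₁ ω₂ ω₃ zero                   = 1F
    coeffs ω₁ ω₂ ω₃ (suc zero)             = bit ω₁
    coeffs ω₁ ω₂ ω₃ (suc (suc zero))       = bit ω₂
    coeffs ω₁ ω₂ ω₃ (suc (suc (suc zero))) = bit ω₃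

  -- Ψ: coordinates (x,y,z,w) = indices 0,1,2,3 of F_p^4.
  e : Fin 4 → FV 4
  e i j with toℕ i ℕ.≟ toℕ j
  ... | yes _ = 1F
  ... | no _  = 0F

  Ψdat : ℤ → LinDatum
  Ψdat a = record
    { Idx  = Fin 4
    ; dim  = 4
    ; Cons = ⊥
    ; con  = λ ()
    ; wdim = wd
    ; φ    = ph
    }
    where
    â : F
    â = ⟦ a ⟧ℤ
    wd : Fin 4 → ℕ
    wd zero                   = 1
    wd (suc zero)             = 1
    wd (suc (suc zero))       = 3
    wd (suc (suc (suc zero))) = 3
    row1 row2 : FV 4
    row1 zero = 1F
    row1 (suc zero) = 0F
    row1 (suc (suc zero)) = â
    row1 (suc (suc (suc zero))) = 1F
    row2 zero = 0F
    row2 (suc zero) = 1F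
    row2 (suc (suc zero)) = 1F
    row2 (suc (suc (suc zero))) = â
    ph : (i : Fin 4) → Mat (wd i) 4
    ph zero _ = row1
    ph (suc zero) _ = row2
    ph (suc (suc zero)) zero = e zero
    ph (suc (suc zero)) (suc zero) = e (suc zero)
    ph (suc (suc zero)) (suc (suc zero)) = e (suc (suc (suc zero)))
    ph (suc (suc (suc zero))) zero = e zero
    ph (suc (suc (suc zero))) (suc zero) = e (suc zero)
    ph (suc (suc (suc zero))) (suc (suc zero)) = e (suc (suc zero))

{-# OPTIONS --safe #-}
module Submission where

-- Call a linear form in (x, y, z, w) flat if its z- or its w-coefficient is 0, that is, if it
-- factors through φ₃ or φ₄ respectively. After k self-joinings, U³ has become 2^k cubes of forms
-- glued along vertices, so a morphism from Ψ is a choice of 2^k affine cubes of forms, agreeing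
-- where they are glued, whose free vertices are φ₁, φ₂ (the two respected copies of 000) or flat.
--
-- Two cubes glued along one vertex turn a pair of forms into another pair. On the
-- (z, w)-coefficients they realise
--   doubling  (2s, v), P         ↦ (s, 2v), P,
--   shearing  (b + g, v), (g, r) ↦ (b, v), (g, r + v)   and its transpose,
-- which keep the sum of the products zw over the pair. Reading off the binary digits of a leads
-- from (a, 1), (1, 0) to (0, v), (1, a), and two more shears lead to (1, a), (0, a - v): this is
-- φ₁ and a flat form transformed into φ₂ and a flat form in O(log |a|) steps. Self-joining a chain
-- of steps along its far end doubles its length, whence the iterated logarithm.

open import Defs
open import Data.Nat using (ℕ; _<_; NonZero)
open import Data.Nat.Primality using (Prime)
open import Data.Integer using (ℤ)
open import Algebra.Bundles using (CommutativeRing)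
open import Algebra.Structures using (IsCommutativeRing)
open import Algebra.Solver.Ring.AlmostCommutativeRing using (fromCommutativeRing; _-Raw-AlmostCommutative⟶_)
import Algebra.Properties.Ring as RingProperties
import Algebra.Properties.Semiring.Sum as SemiringSum
import Algebra.Solver.Ring as RingSolver
open import Axiom.UniquenessOfIdentityProofs.WithK using (uip)
open import Data.Bool using (Bool; true; false; if_then_else_)
open import Data.Fin using (Fin; zero; suc; toℕ; splitAt; _↑ˡ_; _↑ʳ_)
open import Data.Fin.Properties using (toℕ-fromℕ<; toℕ-injective; toℕ<n; toℕ≤n; splitAt-↑ˡ; splitAt-↑ʳ)
open import Data.Integer as ℤ using (+_; -[1+_]; _⊖_; ∣_∣)
open import Data.Integer.DivMod using (_%ℕ_)
import Data.Integer.Properties as ℤ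
open import Data.Maybe as Maybe using (just; nothing)
open import Data.Maybe.Properties using (just-injective)
open import Data.Nat as ℕ using (zero; suc; _∸_; _^_; _≤_; _≤?_; s≤s; z≤n)
open import Data.Nat.DivMod using (_%_; _mod_; m<n⇒m%n≡m; %-distribˡ-+; %-distribˡ-*; n%n≡0; m%n%n≡m%n)
open import Data.Nat.Logarithm using (⌊log₂_⌋; ⌊log₂⌋-mono-≤; ⌊log₂[2^n]⌋≡n)
import Data.Nat.Properties as ℕ
open import Data.Product using (Σ; _×_; _,_)
open import Data.Sum using (_⊎_; inj₁; inj₂; [_,_]′)
open import Function using (_∘_)
open import Level using (0ℓ)
open import Relation.Binary.PropositionalEquality renaming (trans to ≡-trans)
open import Relation.Binary.PropositionalEquality.Algebra using (isMagma)
open import Relation.Nullary using (yes; no; contradiction)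
open import Relation.Nullary.Decidable using (dec⇒maybe)

-- Binary digits and the count of joins.

parity : ∀ u → Σ ℕ λ h → u ≡ h ℕ.+ h ⊎ u ≡ suc (h ℕ.+ h)
parity zero = 0 , inj₁ refl
parity (suc u) with parity u
... | h , inj₁ eq = h , inj₂ (cong suc eq)
... | h , inj₂ eq = suc h , inj₁ (cong suc (≡-trans eq (sym (ℕ.+-suc h h))))

n<2^[1+⌊log₂n⌋] : ∀ n → n < 2 ^ suc ⌊log₂ n ⌋
n<2^[1+⌊log₂n⌋] n = ℕ.≰⇒> λ 2^≤n → ℕ.1+n≰n
  (subst (_≤ ⌊log₂ n ⌋) (⌊log₂[2^n]⌋≡n (suc ⌊log₂ n ⌋)) (⌊log₂⌋-mono-≤ 2^≤n))

-- m binary digits take 2m steps, besides one step to change x to y and two to swap the forms;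
-- 2^s steps cost s + 2 joins.
Mbound-spec : ∀ i → Σ ℕ λ s → Σ ℕ λ m → suc (suc s) ≤ Mbound i × ∣ i ∣ < 2 ^ m × 1 ℕ.+ (m ℕ.* 2 ℕ.+ 2) ≤ 2 ^ s
Mbound-spec i with 4 ≤? ∣ i ∣
... | no  ≱4 = 3 , 2 , ℕ.≤-refl , ℕ.≰⇒> ≱4 , ℕ.n≤1+n 7
-- `1 ℕ.+ L` digits suffice for `∣ i ∣ ∸ 1`, but `∣ i ∣` itself may be the power `2 ^ (1 ℕ.+ L)`;
-- hence one digit more.
... | yes ≥4 = 4 ℕ.+ ⌊log₂ L ⌋ , 2 ℕ.+ L , ℕ.≤-refl , i<2^ , steps
  where
  L = ⌊log₂ (∣ i ∣ ∸ 1) ⌋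
  i<2^ : ∣ i ∣ < 2 ^ (2 ℕ.+ L)
  i<2^ = begin-strict
    ∣ i ∣             ≤⟨ ℕ.m≤n+m∸n ∣ i ∣ 1 ⟩
    suc (∣ i ∣ ∸ 1)   ≤⟨ n<2^[1+⌊log₂n⌋] (∣ i ∣ ∸ 1) ⟩
    2 ^ (1 ℕ.+ L)     <⟨ ℕ.^-monoʳ-< 2 (ℕ.n<1+n 1) (ℕ.n<1+n (1 ℕ.+ L)) ⟩
    2 ^ (2 ℕ.+ L)     ∎
    where open ℕ.≤-Reasoning
  steps : 1 ℕ.+ ((2 ℕ.+ L) ℕ.* 2 ℕ.+ 2) ≤ 2 ^ (4 ℕ.+ ⌊log₂ L ⌋)
  steps = begin
    5 ℕ.+ (L ℕ.* 2 ℕ.+ 2)     ≡⟨ cong (5 ℕ.+_) (ℕ.+-comm (L ℕ.* 2) 2) ⟩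
    7 ℕ.+ L ℕ.* 2             ≤⟨ ℕ.+-mono-≤ (ℕ.n≤1+n 7) (ℕ.*-monoʳ-≤ L (s≤s (s≤s z≤n))) ⟩
    8 ℕ.+ L ℕ.* 8             ≡⟨ ℕ.*-comm (suc L) 8 ⟩
    8 ℕ.* suc L               ≤⟨ ℕ.*-monoʳ-≤ 8 (n<2^[1+⌊log₂n⌋] L) ⟩
    8 ℕ.* 2 ^ suc ⌊log₂ L ⌋   ≡⟨ ℕ.^-distribˡ-+-* 2 3 (suc ⌊log₂ L ⌋) ⟨
    2 ^ (4 ℕ.+ ⌊log₂ L ⌋)     ∎
    where open ℕ.≤-Reasoning

-- Labels of the free vertices.

-- The free vertices of a chain of cubes: the pair of forms p at its near end, the pair q at its
-- far end, and the flat ones.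
data Label : Set where
  p₁ p₂ q₁ q₂ side : Label

isQ : Label → Bool
isQ q₁ = true
isQ q₂ = true
isQ _  = false

-- In the self-joining along q, the near end of the right-hand copy becomes the far end.
relabel : Bool → Label → Label
relabel b p₁ = if b then q₁ else p₁
relabel b p₂ = if b then q₂ else p₂
relabel b _  = side

relabel-p₁ : ∀ b ℓ → relabel b ℓ ≡ p₁ → b ≡ false × ℓ ≡ p₁
relabel-p₁ false p₁ _ = refl , refl
relabel-p₁ true  p₂ ()

relabel-q₁ : ∀ b ℓ → relabel b ℓ ≡ q₁ → b ≡ true × ℓ ≡ p₁
relabel-q₁ true  p₁ _ = refl , refl
relabel-q₁ false p₂ ()

-- These vertices only have to be flat and will be sent to the indices of `φ₃` and `φ₄`. With `p₁`
-- and `q₁` left out, the indices of `φ₁` and `φ₂` are hit once each, as respecting demands.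
data Spare : Label → Set where
  p₂   : Spare p₂
  q₂   : Spare q₂
  side : Spare side

data Corner : Set where
  apex next seam other : Corner

corner : Cube → Corner
corner (false , false , false) = apex
corner (true  , false , false) = next
corner (false , true  , false) = seam
corner _                       = other

isSeam : Corner → Bool
isSeam seam = true
isSeam _    = false

-- A single link consists of two cubes glued at their seams. Its second cube is traversed from
-- next to apex, since shearing adds to the second form what it subtracts from the first.
corner-label : Bool → Corner → Label
corner-label s apex = if s then q₂ else p₁
corner-label s next = if s then p₂ else q₁
corner-label s _    = side

corner-label-p₁ : ∀ s k → corner-label s k ≡ p₁ → s ≡ false × k ≡ apex
corner-label-p₁ false apex _ = refl , refl
corner-label-p₁ true  next ()

corner-apex : ∀ ω → corner ω ≡ apex → ω ≡ (false , false , false)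
corner-apex (false , false , false) _ = refl
corner-apex (false , true  , true)  ()
corner-apex (true  , false , true)  ()

module Proof (p : ℕ) .{{_ : NonZero p}} where

  -- The commutative ring of residues modulo `p`.

  infixl 6 _⊕_
  infixl 7 _⊗_

  _⊕_ _⊗_ : F p → F p → F p
  _⊕_ = _+F_ p
  _⊗_ = _*F_ p

  ⊝_ : F p → F p
  ⊝_ = -F_ p

  ι : ℕ → F p
  ι n = n mod p

  toℕ-ι : ∀ n → toℕ (ι n) ≡ n % p
  toℕ-ι n = toℕ-fromℕ< _

  ι-cong : ∀ {m n} → m % p ≡ n % p → ι m ≡ ι n
  ι-cong {m} {n} eq = toℕ-injective (≡-trans (toℕ-ι m) (≡-trans eq (sym (toℕ-ι n))))

  ι-toℕ : ∀ x → ι (toℕ x) ≡ x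
  ι-toℕ x = toℕ-injective (≡-trans (toℕ-ι (toℕ x)) (m<n⇒m%n≡m (toℕ<n x)))

  ι-+ : ∀ m n → ι (m ℕ.+ n) ≡ ι m ⊕ ι n
  ι-+ m n = ι-cong (≡-trans (%-distribˡ-+ m n p)
    (cong (_% p) (sym (cong₂ ℕ._+_ (toℕ-ι m) (toℕ-ι n)))))

  ι-* : ∀ m n → ι (m ℕ.* n) ≡ ι m ⊗ ι n
  ι-* m n = ι-cong (≡-trans (%-distribˡ-* m n p)
    (cong (_% p) (sym (cong₂ ℕ._*_ (toℕ-ι m) (toℕ-ι n)))))

  ι-+ˡ : ∀ m y → ι m ⊕ y ≡ ι (m ℕ.+ toℕ y)
  ι-+ˡ m y = ≡-trans (cong (ι m ⊕_) (sym (ι-toℕ y))) (sym (ι-+ m (toℕ y)))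

  ι-*ˡ : ∀ m y → ι m ⊗ y ≡ ι (m ℕ.* toℕ y)
  ι-*ˡ m y = ≡-trans (cong (ι m ⊗_) (sym (ι-toℕ y))) (sym (ι-* m (toℕ y)))

  ⊕-comm : ∀ x y → x ⊕ y ≡ y ⊕ x
  ⊕-comm x y = cong ι (ℕ.+-comm (toℕ x) (toℕ y))

  ⊗-comm : ∀ x y → x ⊗ y ≡ y ⊗ x
  ⊗-comm x y = cong ι (ℕ.*-comm (toℕ x) (toℕ y))

  ⊕-assoc : ∀ x y z → (x ⊕ y) ⊕ z ≡ x ⊕ (y ⊕ z)
  ⊕-assoc x y z = begin
    (x ⊕ y) ⊕ z                        ≡⟨ ι-+ˡ _ z ⟩
    ι (toℕ x ℕ.+ toℕ y ℕ.+ toℕ z)      ≡⟨ cong ι (≡-trans (ℕ.+-assoc (toℕ x) _ _) (ℕ.+-comm (toℕ x) _)) ⟩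
    ι (toℕ y ℕ.+ toℕ z ℕ.+ toℕ x)      ≡⟨ ι-+ˡ _ x ⟨
    (y ⊕ z) ⊕ x                        ≡⟨ ⊕-comm (y ⊕ z) x ⟩
    x ⊕ (y ⊕ z)                        ∎
    where open ≡-Reasoning

  ⊗-assoc : ∀ x y z → (x ⊗ y) ⊗ z ≡ x ⊗ (y ⊗ z)
  ⊗-assoc x y z = begin
    (x ⊗ y) ⊗ z                        ≡⟨ ι-*ˡ _ z ⟩
    ι (toℕ x ℕ.* toℕ y ℕ.* toℕ z)      ≡⟨ cong ι (≡-trans (ℕ.*-assoc (toℕ x) _ _) (ℕ.*-comm (toℕ x) _)) ⟩
    ι (toℕ y ℕ.* toℕ z ℕ.* toℕ x)      ≡⟨ ι-*ˡ _ x ⟨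
    (y ⊗ z) ⊗ x                        ≡⟨ ⊗-comm (y ⊗ z) x ⟩
    x ⊗ (y ⊗ z)                        ∎
    where open ≡-Reasoning

  ⊕-identityˡ : ∀ x → ι 0 ⊕ x ≡ x
  ⊕-identityˡ x = ≡-trans (ι-+ˡ 0 x) (ι-toℕ x)

  ⊗-identityˡ : ∀ x → ι 1 ⊗ x ≡ x
  ⊗-identityˡ x = ≡-trans (ι-*ˡ 1 x) (≡-trans (cong ι (ℕ.*-identityˡ (toℕ x))) (ι-toℕ x))

  ⊕-inverseˡ : ∀ x → ⊝ x ⊕ x ≡ ι 0
  ⊕-inverseˡ x = ≡-trans (ι-+ˡ _ x)
    (≡-trans (cong ι (ℕ.m∸n+n≡m (toℕ≤n x))) (ι-cong (≡-trans (n%n≡0 p) (sym (m<n⇒m%n≡m (ℕ.n≢0⇒n>0 (ℕ.≢-nonZero⁻¹ p)))))))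

  ⊗-distribʳ : ∀ x y z → (y ⊕ z) ⊗ x ≡ y ⊗ x ⊕ z ⊗ x
  ⊗-distribʳ x y z = ≡-trans (ι-*ˡ _ x)
    (≡-trans (cong ι (ℕ.*-distribʳ-+ (toℕ x) (toℕ y) (toℕ z))) (ι-+ _ _))

  F-isCommutativeRing : IsCommutativeRing _≡_ _⊕_ _⊗_ ⊝_ (ι 0) (ι 1)
  F-isCommutativeRing = record
    { isRing = record
      { +-isAbelianGroup = record
        { isGroup = record
          { isMonoid = record
            { isSemigroup = record
              { isMagma = isMagma _⊕_
              ; assoc = ⊕-assoc }
            ; identity = ⊕-identityˡ , λ x → ≡-trans (⊕-comm x _) (⊕-identityˡ x) }
          ; inverse = ⊕-inverseˡ , λ x → ≡-trans (⊕-comm x _) (⊕-inverseˡ x)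
          ; ⁻¹-cong = cong ⊝_ }
        ; comm = ⊕-comm }
      ; *-cong = cong₂ _⊗_
      ; *-assoc = ⊗-assoc
      ; *-identity = ⊗-identityˡ , λ x → ≡-trans (⊗-comm x _) (⊗-identityˡ x)
      ; distrib = (λ x y z → ≡-trans (⊗-comm x _) (≡-trans (⊗-distribʳ x y z) (cong₂ _⊕_ (⊗-comm y x) (⊗-comm z x))))
                , ⊗-distribʳ }
    ; *-comm = ⊗-comm }

  F-ring : CommutativeRing 0ℓ 0ℓ
  F-ring = record { isCommutativeRing = F-isCommutativeRing }

  open CommutativeRing F-ring using (ring; semiring; +-identityʳ; -‿inverseʳ; zeroˡ)
  open RingProperties ring using (-‿distribˡ-*; -‿distribʳ-*; -‿involutive; -‿+-comm; -0#≈0#)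

  -- The homomorphism from the integers.

  -- Unlike ⟦_⟧ℤ, this map sends 0 and 1 to 0F and 1F definitionally, as the ring solver needs.
  κ : ℤ → F p
  κ (+ n)    = ι n
  κ -[1+ n ] = ⊝ ι (suc n)

  κ-neg : ∀ i → κ (ℤ.- i) ≡ ⊝ κ i
  κ-neg (+ zero)  = sym -0#≈0#
  κ-neg (+ suc n) = refl
  κ-neg -[1+ n ]  = sym (-‿involutive _)

  κ-⊖ : ∀ m n → κ (m ⊖ n) ≡ ι m ⊕ ⊝ ι n
  κ-⊖ zero    zero    = sym (-‿inverseʳ _)
  κ-⊖ (suc m) zero    = sym (≡-trans (cong (ι (suc m) ⊕_) -0#≈0#) (+-identityʳ _))
  κ-⊖ zero    (suc n) = sym (⊕-identityˡ _)
  κ-⊖ (suc m) (suc n) = begin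
    κ (suc m ⊖ suc n)                          ≡⟨ cong κ (ℤ.[1+m]⊖[1+n]≡m⊖n m n) ⟩
    κ (m ⊖ n)                                  ≡⟨ κ-⊖ m n ⟩
    ι m ⊕ ⊝ ι n                                ≡⟨ cong (_⊕ ⊝ ι n) (≡-trans (sym (+-identityʳ (ι m))) (cong (ι m ⊕_) (sym (-‿inverseʳ (ι 1))))) ⟩
    (ι m ⊕ (ι 1 ⊕ ⊝ ι 1)) ⊕ ⊝ ι n              ≡⟨ cong (_⊕ ⊝ ι n) (sym (⊕-assoc _ _ _)) ⟩
    (ι m ⊕ ι 1) ⊕ ⊝ ι 1 ⊕ ⊝ ι n                ≡⟨ ⊕-assoc _ _ _ ⟩
    (ι m ⊕ ι 1) ⊕ (⊝ ι 1 ⊕ ⊝ ι n)              ≡⟨ cong₂ _⊕_ (≡-trans (⊕-comm (ι m) (ι 1)) (sym (ι-+ 1 m))) (≡-trans (-‿+-comm (ι 1) (ι n)) (cong ⊝_ (sym (ι-+ 1 n)))) ⟩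
    ι (suc m) ⊕ ⊝ ι (suc n)                    ∎
    where open ≡-Reasoning

  κ-+ : ∀ i j → κ (i ℤ.+ j) ≡ κ i ⊕ κ j
  κ-+ (+ m)    (+ n)    = ι-+ m n
  κ-+ (+ m)    -[1+ n ] = κ-⊖ m (suc n)
  κ-+ -[1+ m ] (+ n)    = ≡-trans (κ-⊖ n (suc m)) (⊕-comm (ι n) (⊝ ι (suc m)))
  κ-+ -[1+ m ] -[1+ n ] = ≡-trans (cong (⊝_ ∘ ι ∘ suc) (sym (ℕ.+-suc m n)))
    (≡-trans (cong ⊝_ (ι-+ (suc m) (suc n))) (sym (-‿+-comm (ι (suc m)) (ι (suc n)))))

  κ-*-pos : ∀ m j → κ (+ m ℤ.* j) ≡ ι m ⊗ κ j
  κ-*-pos m (+ n)    = ≡-trans (cong κ (sym (ℤ.pos-* m n))) (ι-* m n)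
  κ-*-pos m -[1+ n ] = begin
    κ (+ m ℤ.* -[1+ n ])        ≡⟨ cong κ (sym (ℤ.neg-distribʳ-* (+ m) (+ suc n))) ⟩
    κ (ℤ.- (+ m ℤ.* + suc n))   ≡⟨ κ-neg (+ m ℤ.* + suc n) ⟩
    ⊝ κ (+ m ℤ.* + suc n)       ≡⟨ cong ⊝_ (κ-*-pos m (+ suc n)) ⟩
    ⊝ (ι m ⊗ ι (suc n))         ≡⟨ -‿distribʳ-* (ι m) (ι (suc n)) ⟩
    ι m ⊗ ⊝ ι (suc n)           ∎
    where open ≡-Reasoning

  κ-* : ∀ i j → κ (i ℤ.* j) ≡ κ i ⊗ κ j
  κ-* (+ m)    j = κ-*-pos m j
  κ-* -[1+ m ] j = begin
    κ (-[1+ m ] ℤ.* j)          ≡⟨ cong κ (sym (ℤ.neg-distribˡ-* (+ suc m) j)) ⟩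
    κ (ℤ.- (+ suc m ℤ.* j))     ≡⟨ κ-neg (+ suc m ℤ.* j) ⟩
    ⊝ κ (+ suc m ℤ.* j)         ≡⟨ cong ⊝_ (κ-*-pos (suc m) j) ⟩
    ⊝ (ι (suc m) ⊗ κ j)         ≡⟨ -‿distribˡ-* (ι (suc m)) (κ j) ⟩
    ⊝ ι (suc m) ⊗ κ j           ∎
    where open ≡-Reasoning

  ι-% : ∀ n → ι (n % p) ≡ ι n
  ι-% n = ι-cong (m%n%n≡m%n n p)

  -- The remainder of a negative integer is defined by cases on `suc n % p`; here that case split is
  -- made once and turned into equations.
  %ℕ-neg : ∀ n → (-[1+ n ] %ℕ p ≡ 0 × suc n % p ≡ 0) ⊎ (-[1+ n ] %ℕ p ≡ p ∸ suc n % p)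
  %ℕ-neg n with suc n % p
  ... | zero  = inj₁ (refl , refl)
  ... | suc r = inj₂ refl

  ⟦⟧ℤ≡κ : ∀ i → ⟦_⟧ℤ p i ≡ κ i
  ⟦⟧ℤ≡κ (+ n) = ι-% n
  ⟦⟧ℤ≡κ -[1+ n ] with %ℕ-neg n
  ... | inj₁ (eq , eq′) = ≡-trans (cong ι eq) (≡-trans (sym -0#≈0#)
    (cong ⊝_ (≡-trans (cong ι (sym eq′)) (ι-% (suc n)))))
  -- `⊝ ι (suc n)` unfolds to `ι (p ∸ toℕ (ι (suc n)))`, so only the subtrahends have to be matched.
  ... | inj₂ eq = cong ι (≡-trans eq (cong (p ∸_) (sym (toℕ-ι (suc n)))))

  κ-morphism : ℤ.+-*-rawRing -Raw-AlmostCommutative⟶ fromCommutativeRing F-ring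
  κ-morphism = record
    { ⟦_⟧ = κ ; +-homo = κ-+ ; *-homo = κ-* ; -‿homo = κ-neg ; 0-homo = refl ; 1-homo = refl }

  open RingSolver ℤ.+-*-rawRing (fromCommutativeRing F-ring) κ-morphism
    (λ i j → Maybe.map (cong κ) (dec⇒maybe (i ℤ.≟ j)))
    using (Polynomial; solve; _:+_; _:*_; :-_; _:=_) renaming (con to lit)

  𝟎 𝟏 : ∀ {n} → Polynomial n
  𝟎 = lit (+ 0)
  𝟏 = lit (+ 1)

  -- Finite sums and dot products.

  open SemiringSum semiring using (sum; sum-cong-≗; ∑-comm; *-distribˡ-sum; *-distribʳ-sum)

  dot : ∀ {n} → FV p n → FV p n → F p
  dot c u = sumF p (λ k → c k ⊗ u k)

  sumF≡sum : ∀ {n} (f : FV p n) → sumF p f ≡ sum f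
  sumF≡sum {zero}  f = refl
  sumF≡sum {suc n} f = cong (f zero ⊕_) (sumF≡sum (f ∘ suc))

  sumF-cong : ∀ {n} {f g : FV p n} → (∀ k → f k ≡ g k) → sumF p f ≡ sumF p g
  sumF-cong {zero}  eq = refl
  sumF-cong {suc n} eq = cong₂ _⊕_ (eq zero) (sumF-cong (eq ∘ suc))

  -- Associativity of the product row, matrix, column, by exchanging the two sums. It moves
  -- functionals and forms of a datum across the map `θ` of a morphism.
  dot-comb : ∀ {m n} (c : FV p m) (A : Mat p m n) (v : FV p n) →
             dot (λ j → dot c (λ k → A k j)) v ≡ dot c (λ k → dot (A k) v)
  dot-comb {m} {n} c A v = begin
    sumF p (λ j → dot c (λ k → A k j) ⊗ v j)     ≡⟨ sumF≡sum {n} (λ j → dot c (λ k → A k j) ⊗ v j) ⟩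
    sum (λ j → dot c (λ k → A k j) ⊗ v j)        ≡⟨ sum-cong-≗ outer ⟩
    sum (λ j → sum (λ k → c k ⊗ A k j ⊗ v j))    ≡⟨ ∑-comm (λ j k → c k ⊗ A k j ⊗ v j) ⟩
    sum (λ k → sum (λ j → c k ⊗ A k j ⊗ v j))    ≡⟨ sum-cong-≗ inner ⟩
    sum (λ k → c k ⊗ dot (A k) v)                ≡⟨ sumF≡sum {m} (λ k → c k ⊗ dot (A k) v) ⟨
    sumF p (λ k → c k ⊗ dot (A k) v)             ∎
    where
    open ≡-Reasoning
    outer : ∀ j → dot c (λ k → A k j) ⊗ v j ≡ sum (λ k → c k ⊗ A k j ⊗ v j)
    outer j = ≡-trans (cong (_⊗ v j) (sumF≡sum {m} (λ k → c k ⊗ A k j))) (*-distribʳ-sum {m} (v j) (λ k → c k ⊗ A k j))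
    inner : ∀ k → sum (λ j → c k ⊗ A k j ⊗ v j) ≡ c k ⊗ dot (A k) v
    inner k = ≡-trans (sum-cong-≗ (λ j → ⊗-assoc (c k) (A k j) (v j)))
      (≡-trans (sym (*-distribˡ-sum {n} (c k) (λ j → A k j ⊗ v j))) (cong (c k ⊗_) (sym (sumF≡sum {n} (λ j → A k j ⊗ v j)))))

  sumF-++ : ∀ m {n} (f : FV p (m ℕ.+ n)) →
            sumF p f ≡ sumF p (λ k → f (k ↑ˡ n)) ⊕ sumF p (λ k → f (m ↑ʳ k))
  sumF-++ zero    f = sym (⊕-identityˡ _)
  sumF-++ (suc m) f = ≡-trans (cong (f zero ⊕_) (sumF-++ m (f ∘ suc))) (sym (⊕-assoc _ _ _))

  dot-split : ∀ {m n} (c u : FV p m) (d v : FV p n) →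
              dot (λ k → [ c , d ]′ (splitAt m k)) (λ k → [ u , v ]′ (splitAt m k)) ≡ dot c u ⊕ dot d v
  dot-split {m} {n} c u d v = ≡-trans (sumF-++ m _) (cong₂ _⊕_
    (sumF-cong (λ k → cong (λ s → [ c , d ]′ s ⊗ [ u , v ]′ s) (splitAt-↑ˡ m k n)))
    (sumF-cong (λ k → cong (λ s → [ c , d ]′ s ⊗ [ u , v ]′ s) (splitAt-↑ʳ m n k))))

  dot-zeroˡ : ∀ {n} (u : FV p n) → dot (λ _ → ι 0) u ≡ ι 0
  dot-zeroˡ {zero}  u = refl
  dot-zeroˡ {suc n} u = ≡-trans (cong₂ _⊕_ (zeroˡ (u zero)) (dot-zeroˡ (u ∘ suc))) (⊕-identityˡ _)

  dot-neg : ∀ {n} (c u : FV p n) → dot (λ k → ⊝ c k) u ≡ ⊝ dot c u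
  dot-neg {zero}  c u = sym -0#≈0#
  dot-neg {suc n} c u = ≡-trans (cong₂ _⊕_ (sym (-‿distribˡ-* (c zero) (u zero))) (dot-neg (c ∘ suc) (u ∘ suc)))
    (-‿+-comm (c zero ⊗ u zero) (dot (c ∘ suc) (u ∘ suc)))

  -- Configurations of forms and their self-joinings.

  -- A linear map F⁴ → V; row r of form i holds the coefficients of the pulled back (φ i)_r.
  record Config (D : LinDatum p) : Set where
    field
      mat : Mat p (dim D) 4

    column : Fin 4 → FV p (dim D)
    column j k = mat k j

    field
      sat : ∀ c j → dot (con D c) (column j) ≡ ι 0

    form : (i : Idx D) → Mat p (wdim D i) 4
    form i r j = dot (φ D i r) (column j)

  open Config

  record Form : Set where
    constructor ⟨_,_,_,_⟩
    field x y z w : F p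

  at : Form → FV p 4
  at ⟨ x , y , z , w ⟩ zero                   = x
  at ⟨ x , y , z , w ⟩ (suc zero)             = y
  at ⟨ x , y , z , w ⟩ (suc (suc zero))       = z
  at ⟨ x , y , z , w ⟩ (suc (suc (suc zero))) = w

  State : Set
  State = Form × Form

  𝐳 𝐰 : Fin 4
  𝐳 = suc (suc zero)
  𝐰 = suc (suc (suc zero))

  -- The vanishing coordinate is the same for all rows, so that the whole map factors through one of
  -- `φ₃`, `φ₄`.
  Axis : ∀ {m} → Mat p m 4 → Set
  Axis f = (∀ r → f r 𝐳 ≡ ι 0) ⊎ (∀ r → f r 𝐰 ≡ ι 0)

  Fits : Label → State → State → ∀ {m} → Mat p m 4 → Set
  Fits p₁   (A , _) _       f = ∀ r j → f r j ≡ at A j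
  Fits p₂   (_ , A) _       f = ∀ r j → f r j ≡ at A j
  Fits q₁   _       (A , _) f = ∀ r j → f r j ≡ at A j
  Fits q₂   _       (_ , A) f = ∀ r j → f r j ≡ at A j
  Fits side _       _       f = Axis f

  Axis-resp : ∀ {m} {f g : Mat p m 4} → (∀ r j → g r j ≡ f r j) → Axis f → Axis g
  Axis-resp eq (inj₁ z) = inj₁ (λ r → ≡-trans (eq r 𝐳) (z r))
  Axis-resp eq (inj₂ w) = inj₂ (λ r → ≡-trans (eq r 𝐰) (w r))

  -- Only vertices off the glued end survive the joining, so the middle state `M` no longer occurs;
  -- the near end of the right-hand copy carries `Q`.
  Fits-relabel : ∀ b ℓ {P Q M m} {f g : Mat p m 4} → isQ ℓ ≡ false → (∀ r j → g r j ≡ f r j) →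
                 Fits ℓ (if b then Q else P) M f → Fits (relabel b ℓ) P Q g
  Fits-relabel false p₁   _ eq h = λ r j → ≡-trans (eq r j) (h r j)
  Fits-relabel false p₂   _ eq h = λ r j → ≡-trans (eq r j) (h r j)
  Fits-relabel false side _ eq h = Axis-resp eq h
  Fits-relabel true  p₁   _ eq h = λ r j → ≡-trans (eq r j) (h r j)
  Fits-relabel true  p₂   _ eq h = λ r j → ≡-trans (eq r j) (h r j)
  Fits-relabel true  side _ eq h = Axis-resp eq h

  Fits-agree : ∀ ℓ {P Q M m} {f g : Mat p m 4} → isQ ℓ ≡ true →
               Fits ℓ P M f → Fits ℓ Q M g → ∀ r j → f r j ≡ g r j
  Fits-agree q₁ _ h k r j = ≡-trans (h r j) (sym (k r j))
  Fits-agree q₂ _ h k r j = ≡-trans (h r j) (sym (k r j))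

  module _ {D : LinDatum p} (S : Idx D → Bool) (c d : Config D)
           (agree : ∀ i → S i ≡ true → ∀ r j → form c i r j ≡ form d i r j) where

    selfJoin-config : Config (selfJoin p D S)
    selfJoin-config .mat k j = [ column c j , column d j ]′ (splitAt (dim D) k)
    selfJoin-config .sat (inj₁ x) j =
      ≡-trans (dot-split (con D x) (column c j) (λ _ → ι 0) (column d j))
      (≡-trans (cong₂ _⊕_ (sat c x j) (dot-zeroˡ (column d j))) (⊕-identityˡ (ι 0)))
    selfJoin-config .sat (inj₂ (inj₁ x)) j =
      ≡-trans (dot-split (λ _ → ι 0) (column c j) (con D x) (column d j))
      (≡-trans (cong₂ _⊕_ (dot-zeroˡ (column c j)) (sat d x j)) (⊕-identityˡ (ι 0)))
    selfJoin-config .sat (inj₂ (inj₂ (i , i∈S , r))) j =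
      ≡-trans (dot-split (φ D i r) (column c j) (λ k → ⊝ φ D i r k) (column d j))
      (≡-trans (cong₂ _⊕_ (agree i i∈S r j) (dot-neg (φ D i r) (column d j))) (-‿inverseʳ (form d i r j)))

    selfJoin-form : ∀ b i (i∉S : S i ≡ false) r j →
                    form selfJoin-config (b , i , i∉S) r j ≡ form (if b then d else c) i r j
    selfJoin-form false i _ r j =
      ≡-trans (dot-split (φ D i r) (column c j) (λ _ → ι 0) (column d j))
      (≡-trans (cong (form c i r j ⊕_) (dot-zeroˡ (column d j))) (+-identityʳ (form c i r j)))
    selfJoin-form true i _ r j =
      ≡-trans (dot-split (λ _ → ι 0) (column c j) (φ D i r) (column d j))
      (≡-trans (cong (_⊕ form d i r j) (dot-zeroˡ (column c j))) (⊕-identityˡ (form d i r j)))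

  -- Ladders: chains of cubes and their doubling.

  origin : Cube
  origin = false , false , false

  -- Only the vertex labelled `p₁` is followed through `γ`. The far end of a doubled ladder is the
  -- mirror image of the near end, so the last joining yields the second copy of `origin`, with bit
  -- 1, from the same data.
  record Ladder (n : ℕ) : Set₁ where
    field
      datum      : LinDatum p
      {γ}        : PMap (Idx datum) Cube
      derives    : Derives p (U3 p) n datum γ
      wdim≡1     : ∀ i → wdim datum i ≡ 1
      label      : Idx datum → Label
      end        : Idx datum
      label-end  : label end ≡ p₁
      end-unique : ∀ i → label i ≡ p₁ → i ≡ end
      γ-end      : γ end ≡ just (origin , false)

    glued : Idx datum → Bool
    glued = isQ ∘ label

    Links : State → State → Set
    Links P Q = Σ (Config datum) λ c → ∀ i → Fits (label i) P Q (form c i)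

    end-free : glued end ≡ false
    end-free = cong isQ label-end

    joined : LinDatum p
    joined = selfJoin p datum glued

    joined-γ : PMap (Idx joined) Cube
    joined-γ = composeγ γ (joinγ p datum glued)

    joined-label : Idx joined → Label
    joined-label (b , i , _) = relabel b (label i)

    joined-derives : Derives p (U3 p) (suc n) joined joined-γ
    -- Weakening only rewrites the count `n ℕ.+ 1` as `suc n`.
    joined-derives = weaken (ℕ.≤-reflexive (ℕ.+-comm n 1)) (λ _ _ eq → eq) (trans derives (join glued))

    left-end right-end : Idx joined
    left-end  = false , end , end-free
    right-end = true , end , end-free

    -- An index of a self-joining contains a proof that it is not glued; uniqueness of identity
    -- proofs makes the choice of that proof irrelevant.
    joined-end : ∀ {b} i (i∉ : glued i ≡ false) → label i ≡ p₁ →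
                 _≡_ {A = Idx joined} (b , i , i∉) (b , end , end-free)
    joined-end i i∉ eq with end-unique i eq
    ... | refl = cong (λ h → _ , end , h) (uip i∉ end-free)

    left-end-unique : ∀ i → joined-label i ≡ p₁ → i ≡ left-end
    left-end-unique (b , i , i∉) eq with relabel-p₁ b (label i) eq
    ... | refl , eq′ = joined-end i i∉ eq′

    right-end-unique : ∀ i → joined-label i ≡ q₁ → i ≡ right-end
    right-end-unique (b , i , i∉) eq with relabel-q₁ b (label i) eq
    ... | refl , eq′ = joined-end i i∉ eq′

    joined-γ-end : ∀ b → joined-γ (b , end , end-free) ≡ just (origin , b)
    joined-γ-end b rewrite γ-end = refl

  open Ladder

  double : ∀ {n} → Ladder n → Ladder (suc n)
  double L = record
    { datum      = joined L
    ; derives    = joined-derives L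
    ; wdim≡1     = λ { (_ , i , _) → wdim≡1 L i }
    ; label      = joined-label L
    ; end        = left-end L
    ; label-end  = cong (relabel false) (label-end L)
    ; end-unique = left-end-unique L
    ; γ-end      = joined-γ-end L false
    }

  -- Both links end in `M`, where the copies are glued; the second is therefore read backwards, from
  -- `M` to `Q`.
  double-Links : ∀ {n} (L : Ladder n) {P Q M} → Links L P M → Links L Q M → Links (double L) P Q
  double-Links L {P} {Q} {M} (c , h) (d , k) =
    selfJoin-config (glued L) c d agree ,
    λ { (b , i , i∉) → Fits-relabel b (label L i) i∉ (selfJoin-form (glued L) c d agree b i i∉) (pick b i) }
    where
    agree : ∀ i → glued L i ≡ true → ∀ r j → form c i r j ≡ form d i r j
    agree i i∈ = Fits-agree (label L i) i∈ (h i) (k i)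
    pick : ∀ b i → Fits (label L i) (if b then Q else P) M (form (if b then d else c) i)
    pick false = h
    pick true  = k

  -- Single cubes and the base ladder.

  cubeMat : (A B G h : FV p 4) → Mat p 4 4
  cubeMat A B G h zero                   j = A j
  cubeMat A B G h (suc zero)             j = B j ⊕ ⊝ A j
  cubeMat A B G h (suc (suc zero))       j = G j ⊕ ⊝ A j
  cubeMat A B G h (suc (suc (suc zero))) j = h j

  cubeConfig : (A B G h : FV p 4) → Config (U3 p)
  cubeConfig A B G h = record { mat = cubeMat A B G h ; sat = λ () }

  Flat : FV p 4 → Set
  Flat f = f 𝐳 ≡ ι 0 ⊎ f 𝐰 ≡ ι 0

  -- The cube with vertices A, B, G at 000, 100, 010 and third edge h, all other vertices being flat.
  record Cell (A B G : Form) : Set where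
    field
      h     : FV p 4
      a+h   : Flat (λ j → at A j ⊕ h j)
      b+h   : Flat (λ j → at B j ⊕ h j)
      g+h   : Flat (λ j → at G j ⊕ h j)
      far   : Flat (λ j → at B j ⊕ at G j ⊕ ⊝ at A j)
      far+h : Flat (λ j → at B j ⊕ at G j ⊕ ⊝ at A j ⊕ h j)

    config : Config (U3 p)
    config = cubeConfig (at A) (at B) (at G) h

  open Cell

  Corner-fits : Corner → (A B G : Form) → ∀ {m} → Mat p m 4 → Set
  Corner-fits apex  A B G f = ∀ r j → f r j ≡ at A j
  Corner-fits next  A B G f = ∀ r j → f r j ≡ at B j
  Corner-fits seam  A B G f = ∀ r j → f r j ≡ at G j
  Corner-fits other A B G f = Axis f

  Flat⇒Axis : ∀ {m} {f : Mat p m 4} {k : FV p 4} → (∀ r j → f r j ≡ k j) → Flat k → Axis f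
  Flat⇒Axis eq (inj₁ z) = inj₁ (λ r → ≡-trans (eq r 𝐳) z)
  Flat⇒Axis eq (inj₂ w) = inj₂ (λ r → ≡-trans (eq r 𝐰) w)

  -- The expression to which a form of the cube unfolds at the vertex `(k, l, m)`, final zero
  -- included, so that the solver closes the goals by `refl`.
  vertex : ∀ {n} → ℕ → ℕ → ℕ → (a b g h : Polynomial n) → Polynomial n
  vertex k l m a b g h = 𝟏 :* a :+ (lit (+ k) :* (b :+ :- a) :+
    (lit (+ l) :* (g :+ :- a) :+ (lit (+ m) :* h :+ 𝟎)))

  cell-fits : ∀ {A B G} (c : Cell A B G) ω → Corner-fits (corner ω) A B G (form (config c) ω)
  cell-fits {A} {B} {G} c (false , false , false) r j =
    solve 4 (λ a b g h → vertex 0 0 0 a b g h := a) refl (at A j) (at B j) (at G j) (h c j)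
  cell-fits {A} {B} {G} c (true , false , false) r j =
    solve 4 (λ a b g h → vertex 1 0 0 a b g h := b) refl (at A j) (at B j) (at G j) (h c j)
  cell-fits {A} {B} {G} c (false , true , false) r j =
    solve 4 (λ a b g h → vertex 0 1 0 a b g h := g) refl (at A j) (at B j) (at G j) (h c j)
  cell-fits {A} {B} {G} c (false , false , true) = Flat⇒Axis (λ r j →
    solve 4 (λ a b g h → vertex 0 0 1 a b g h := a :+ h) refl (at A j) (at B j) (at G j) (h c j)) (a+h c)
  cell-fits {A} {B} {G} c (true , false , true) = Flat⇒Axis (λ r j →
    solve 4 (λ a b g h → vertex 1 0 1 a b g h := b :+ h) refl (at A j) (at B j) (at G j) (h c j)) (b+h c)
  cell-fits {A} {B} {G} c (false , true , true) = Flat⇒Axis (λ r j →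
    solve 4 (λ a b g h → vertex 0 1 1 a b g h := g :+ h) refl (at A j) (at B j) (at G j) (h c j)) (g+h c)
  cell-fits {A} {B} {G} c (true , true , false) = Flat⇒Axis (λ r j →
    solve 4 (λ a b g h → vertex 1 1 0 a b g h := b :+ g :+ :- a) refl (at A j) (at B j) (at G j) (h c j)) (far c)
  cell-fits {A} {B} {G} c (true , true , true) = Flat⇒Axis (λ r j →
    solve 4 (λ a b g h → vertex 1 1 1 a b g h := b :+ g :+ :- a :+ h) refl (at A j) (at B j) (at G j) (h c j)) (far+h c)

  glue : Cube → Bool
  glue = isSeam ∘ corner

  base : Ladder 1
  base = record
    { datum      = selfJoin p (U3 p) glue
    ; derives    = join glue
    ; wdim≡1     = λ _ → refl
    ; label      = λ { (s , ω , _) → corner-label s (corner ω) }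
    ; end        = false , origin , refl
    ; label-end  = refl
    ; end-unique = λ { (s , ω , ω∉) → unique s ω ω∉ }
    ; γ-end      = refl
    }
    where
    unique : ∀ s ω (ω∉ : glue ω ≡ false) → corner-label s (corner ω) ≡ p₁ →
             _≡_ {A = Idx (selfJoin p (U3 p) glue)} (s , ω , ω∉) (false , origin , refl)
    unique s ω ω∉ eq with corner-label-p₁ s (corner ω) eq
    ... | refl , eq′ with corner-apex ω eq′
    ...   | refl = cong (λ h → false , origin , h) (uip ω∉ refl)

  -- `G` sits at the common seam. That vertex is glued and disappears, so `G` need not be flat.
  Gate : State → State → Set
  Gate (P₁ , P₂) (Q₁ , Q₂) = Σ Form λ G → Cell P₁ Q₁ G × Cell Q₂ P₂ G

  Gate⇒Links : ∀ {P Q} → Gate P Q → Links base P Q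
  Gate⇒Links {P₁ , P₂} {Q₁ , Q₂} (G , c , d) =
    selfJoin-config glue (config c) (config d) agree ,
    λ { (s , ω , ω∉) → fits s (corner ω) ω∉ (selfJoin-form glue (config c) (config d) agree s ω ω∉) (pick s ω) }
    where
    agree-at : ∀ k {m} {f f′ : Mat p m 4} → isSeam k ≡ true → Corner-fits k P₁ Q₁ G f → Corner-fits k Q₂ P₂ G f′ →
               ∀ r j → f r j ≡ f′ r j
    agree-at seam _ u v r j = ≡-trans (u r j) (sym (v r j))
    agree : ∀ ω → glue ω ≡ true → ∀ r j → form (config c) ω r j ≡ form (config d) ω r j
    agree ω eq = agree-at (corner ω) eq (cell-fits c ω) (cell-fits d ω)
    pick : ∀ s ω → Corner-fits (corner ω) (if s then Q₂ else P₁) (if s then P₂ else Q₁) G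
                               (form (if s then config d else config c) ω)
    pick false = cell-fits c
    pick true  = cell-fits d
    fits : ∀ s k {m} {f f′ : Mat p m 4} → isSeam k ≡ false → (∀ r j → f′ r j ≡ f r j) →
           Corner-fits k (if s then Q₂ else P₁) (if s then P₂ else Q₁) G f →
           Fits (corner-label s k) (P₁ , P₂) (Q₁ , Q₂) f′
    fits false apex  _ eq u = λ r j → ≡-trans (eq r j) (u r j)
    fits true  apex  _ eq u = λ r j → ≡-trans (eq r j) (u r j)
    fits false next  _ eq u = λ r j → ≡-trans (eq r j) (u r j)
    fits true  next  _ eq u = λ r j → ≡-trans (eq r j) (u r j)
    fits _     other _ eq u = Axis-resp eq u

  -- The elementary moves.

  -- The z-coefficient `g` of the seam is free, so that an idle cube can be glued to the seam of
  -- `cell-double`.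
  cell-id : ∀ {x y x′ y′ x″ y″} u v g → Cell ⟨ x , y , u , v ⟩ ⟨ x′ , y′ , u , v ⟩ ⟨ x″ , y″ , g , ι 0 ⟩
  cell-id u v g = record
    { h     = at ⟨ ι 0 , ι 0 , ⊝ u , ι 0 ⟩
    ; a+h   = inj₁ (-‿inverseʳ u)
    ; b+h   = inj₁ (-‿inverseʳ u)
    ; g+h   = inj₂ (⊕-identityˡ (ι 0))
    ; far   = inj₂ (solve 1 (λ v → v :+ 𝟎 :+ :- v := 𝟎) refl v)
    ; far+h = inj₂ (solve 1 (λ v → v :+ 𝟎 :+ :- v :+ 𝟎 := 𝟎) refl v)
    }

  cell-add-z : ∀ {x y x′ y′ x″ y″} b g v →
               Cell ⟨ x , y , b ⊕ g , v ⟩ ⟨ x′ , y′ , b , v ⟩ ⟨ x″ , y″ , g , v ⟩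
  cell-add-z b g v = record
    { h     = at ⟨ ι 0 , ι 0 , ι 0 , ⊝ v ⟩
    ; a+h   = inj₂ (-‿inverseʳ v)
    ; b+h   = inj₂ (-‿inverseʳ v)
    ; g+h   = inj₂ (-‿inverseʳ v)
    ; far   = inj₁ (-‿inverseʳ (b ⊕ g))
    ; far+h = inj₂ (solve 1 (λ v → v :+ v :+ :- v :+ :- v := 𝟎) refl v)
    }

  cell-add-w : ∀ {x y x′ y′ x″ y″} u b g →
               Cell ⟨ x , y , u , b ⊕ g ⟩ ⟨ x′ , y′ , u , b ⟩ ⟨ x″ , y″ , u , g ⟩
  cell-add-w u b g = record
    { h     = at ⟨ ι 0 , ι 0 , ⊝ u , ι 0 ⟩
    ; a+h   = inj₁ (-‿inverseʳ u)
    ; b+h   = inj₁ (-‿inverseʳ u)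
    ; g+h   = inj₁ (-‿inverseʳ u)
    ; far   = inj₂ (-‿inverseʳ (b ⊕ g))
    ; far+h = inj₁ (solve 1 (λ u → u :+ u :+ :- u :+ :- u := 𝟎) refl u)
    }

  -- The third edge `(- s, - v)` clears w at the vertex over A and z over B and G. Opposite A the
  -- sums cancel: `s + s - 2s` in z, and with the edge added `2v - v - v` in w.
  cell-double : ∀ {x y x′ y′ x″ y″} s v →
                Cell ⟨ x , y , s ⊕ s , v ⟩ ⟨ x′ , y′ , s , v ⊕ v ⟩ ⟨ x″ , y″ , s , ι 0 ⟩
  cell-double s v = record
    { h     = at ⟨ ι 0 , ι 0 , ⊝ s , ⊝ v ⟩
    ; a+h   = inj₂ (-‿inverseʳ v)
    ; b+h   = inj₁ (-‿inverseʳ s)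
    ; g+h   = inj₁ (-‿inverseʳ s)
    ; far   = inj₁ (-‿inverseʳ (s ⊕ s))
    ; far+h = inj₂ (solve 1 (λ v → v :+ v :+ 𝟎 :+ :- v :+ :- v := 𝟎) refl v)
    }

  -- Flatness does not constrain the x- and y-coefficients, so every move may change them at will.
  module _ {x y x′ y′ X Y X′ Y′ : F p} where

    gate-id : ∀ {u v u′ v′} → Gate (⟨ x , y , u , v ⟩ , ⟨ X , Y , u′ , v′ ⟩) (⟨ x′ , y′ , u , v ⟩ , ⟨ X′ , Y′ , u′ , v′ ⟩)
    gate-id {u} {v} {u′} {v′} = ⟨ ι 0 , ι 0 , ι 0 , ι 0 ⟩ , cell-id u v (ι 0) , cell-id u′ v′ (ι 0)

    gate-double : ∀ s v u′ v′ → Gate (⟨ x , y , s ⊕ s , v ⟩ , ⟨ X , Y , u′ , v′ ⟩) (⟨ x′ , y′ , s , v ⊕ v ⟩ , ⟨ X′ , Y′ , u′ , v′ ⟩)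
    gate-double s v u′ v′ = ⟨ ι 0 , ι 0 , s , ι 0 ⟩ , cell-double s v , cell-id u′ v′ s

    -- The seam is `(g, v)`. The first cube takes `g` off a z-coefficient beside w-coefficient `v`;
    -- the second, traversed backwards, adds `v` to a w-coefficient beside z-coefficient `g`. The
    -- changes `- gv` and `gv` of the products cancel.
    gate-shear : ∀ b g v r → Gate (⟨ x , y , b ⊕ g , v ⟩ , ⟨ X , Y , g , r ⟩) (⟨ x′ , y′ , b , v ⟩ , ⟨ X′ , Y′ , g , r ⊕ v ⟩)
    gate-shear b g v r = ⟨ ι 0 , ι 0 , g , v ⟩ , cell-add-z b g v , cell-add-w g r v

    gate-shearᵗ : ∀ u b g r → Gate (⟨ x , y , u , b ⊕ g ⟩ , ⟨ X , Y , r , g ⟩) (⟨ x′ , y′ , u , b ⟩ , ⟨ X′ , Y′ , r ⊕ u , g ⟩)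
    gate-shearᵗ u b g r = ⟨ ι 0 , ι 0 , u , g ⟩ , cell-add-w u b g , cell-add-z r u g

  -- Paths of moves laid out on ladders.

  -- Gates are traversed alternately forwards and backwards, as each join reflects the chain.
  Step : State → State → Set
  Step P Q = Σ State λ M → Gate P M × Gate Q M

  Step-sym : ∀ {P Q} → Step P Q → Step Q P
  Step-sym (M , s , t) = M , t , s

  Gate⇒Step : ∀ {P Q} → Gate P Q → Step P Q
  Gate⇒Step {Q = Q} s = Q , s , gate-id

  Path : ℕ → State → State → Set
  Path zero    P Q = P ≡ Q
  Path (suc n) P Q = Σ State λ M → Step P M × Path n M Q

  infixr 5 _++_
  _++_ : ∀ {m n P Q R} → Path m P Q → Path n Q R → Path (m ℕ.+ n) P R
  _++_ {zero}  refl        τ = τ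
  _++_ {suc m} (M , s , π) τ = M , s , _++_ {m} π τ

  Path-split : ∀ m {n P R} → Path (m ℕ.+ n) P R → Σ State λ Q → Path m P Q × Path n Q R
  Path-split zero    π           = _ , refl , π
  Path-split (suc m) (M , s , π) with Path-split m π
  ... | Q , π₁ , π₂ = Q , (M , s , π₁) , π₂

  Path-idle : ∀ n {P} → Path n P P
  Path-idle zero    = refl
  Path-idle (suc n) = _ , Gate⇒Step gate-id , Path-idle n

  Path-sym : ∀ n {P Q} → Path n P Q → Path n Q P
  Path-sym zero    refl        = refl
  Path-sym (suc n) {P} {Q} (M , s , π) = subst (λ k → Path k Q P) (ℕ.+-comm n 1)
    (_++_ {n} {1} (Path-sym n π) (P , Step-sym s , refl))

  Path-pad : ∀ {m n P Q} → m ≤ n → Path m P Q → Path n P Q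
  Path-pad {m} {n} {P} {Q} m≤n π =
    subst (λ k → Path k P Q) (ℕ.m+[n∸m]≡n m≤n) (_++_ {m} π (Path-idle (n ∸ m)))

  ladder : ∀ s → Ladder (suc s)
  ladder zero    = base
  ladder (suc s) = double (ladder s)

  -- Induction by halving the path: doubling reflects the right-hand copy, so the second half is
  -- reversed before the induction hypothesis is applied. A single step consists of two gates with a
  -- common far state, which is a link of the doubled base.
  Path⇒Links : ∀ s {P Q} → Path (2 ^ s) P Q → Links (ladder (suc s)) P Q
  Path⇒Links zero    (_ , (M , t , u) , refl) = double-Links base (Gate⇒Links t) (Gate⇒Links u)
  Path⇒Links (suc s) {P} {Q} π with Path-split (2 ^ s) π
  ... | M , π₁ , π₂ = double-Links (ladder (suc s)) (Path⇒Links s π₁)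
    -- `2 ^ suc s` unfolds to `2 ^ s ℕ.+ (2 ^ s ℕ.+ 0)`, hence the transport.
    (Path⇒Links s (Path-sym (2 ^ s) (subst (λ k → Path k M Q) (ℕ.+-identityʳ (2 ^ s)) π₂)))

  -- The route from `φ₁` to `φ₂` along binary digits.

  active : F p → F p → Form
  active z w = ⟨ ι 0 , ι 1 , z , w ⟩

  spare : F p → F p → Form
  spare z w = ⟨ ι 0 , ι 0 , z , w ⟩

  ι-bit : ∀ h → ι (suc (h ℕ.+ h)) ≡ ι 1 ⊕ (ι h ⊕ ι h)
  ι-bit h = ≡-trans (ι-+ 1 (h ℕ.+ h)) (cong (ι 1 ⊕_) (ι-+ h h))

  -- With c = ±1, the sum of the products of the z- and w-coefficients of both forms is c (r + u v).
  digit : ∀ u c v r → Σ ℕ λ h → Σ (F p) λ r′ → h ℕ.+ h ≤ u × r′ ⊕ ι h ⊗ (v ⊕ v) ≡ r ⊕ ι u ⊗ v ×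
          Path 2 (active (ι u ⊗ c) v , spare c r) (active (ι h ⊗ c) (v ⊕ v) , spare c r′)
  digit u c v r with parity u
  ... | h , inj₁ refl = h , r , ℕ.≤-refl ,
    ≡-trans (solve 3 (λ r h v → r :+ h :* (v :+ v) := r :+ (h :+ h) :* v) refl r (ι h) v)
      (cong (λ k → r ⊕ k ⊗ v) (sym (ι-+ h h))) ,
    subst (λ k → Path 2 (active k v , spare c r) (active (ι h ⊗ c) (v ⊕ v) , spare c r))
      (sym (≡-trans (cong (_⊗ c) (ι-+ h h)) (⊗-distribʳ c (ι h) (ι h))))
      -- A digit 0 needs the doubling alone; the idle step keeps two steps per digit.
      (_ , Gate⇒Step (gate-double (ι h ⊗ c) v c r) , Path-idle 1)
  ... | h , inj₂ refl = h , r ⊕ v , ℕ.n≤1+n (h ℕ.+ h) ,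
    ≡-trans (solve 3 (λ r h v → r :+ v :+ h :* (v :+ v) := r :+ (𝟏 :+ (h :+ h)) :* v) refl r (ι h) v)
      (cong (λ k → r ⊕ k ⊗ v) (sym (ι-bit h))) ,
    subst (λ k → Path 2 (active k v , spare c r) (active (ι h ⊗ c) (v ⊕ v) , spare c (r ⊕ v)))
      (sym (≡-trans (cong (_⊗ c) (ι-bit h))
        (solve 2 (λ h c → (𝟏 :+ (h :+ h)) :* c := h :* c :+ h :* c :+ c) refl (ι h) c)))
      ((active (ι h ⊗ c ⊕ ι h ⊗ c) v , spare c (r ⊕ v)) , Gate⇒Step (gate-shear (ι h ⊗ c ⊕ ι h ⊗ c) c v r) ,
       _ , Gate⇒Step (gate-double (ι h ⊗ c) v c (r ⊕ v)) , refl)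

  -- Once all digits are used up the multiplier is 0, and the invariant of `digit` leaves
  -- `r ⊕ ι u ⊗ v` in the spare form. The value of `v′` may stay unknown, as it ends up only in a
  -- form that is flat anyway.
  digits : ∀ m u c v r → u < 2 ^ m → Σ (F p) λ v′ →
           Path (m ℕ.* 2) (active (ι u ⊗ c) v , spare c r) (active (ι 0) v′ , spare c (r ⊕ ι u ⊗ v))
  digits zero zero c v r _ = v , cong₂ (λ s t → active s v , spare c t) (zeroˡ c)
    (solve 2 (λ r v → r := r :+ 𝟎 :* v) refl r v)
  digits zero (suc u) c v r (s≤s ())
  digits (suc m) u c v r u<2^ with digit u c v r
  ... | h , r′ , 2h≤u , eq , π with digits m h c (v ⊕ v) r′ (halve 2h≤u)
    where
    halve : h ℕ.+ h ≤ u → h < 2 ^ m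
    halve 2h≤u = ℕ.*-cancelˡ-< 2 h (2 ^ m)
      (ℕ.≤-<-trans (subst (_≤ u) (cong (h ℕ.+_) (sym (ℕ.+-identityʳ h))) 2h≤u) u<2^)
  ...   | v′ , τ = v′ , _++_ {2} π
    (subst (λ t → Path (m ℕ.* 2) (active (ι h ⊗ c) (v ⊕ v) , spare c r′) (active (ι 0) v′ , spare c t)) eq τ)

  -- Two shears run backwards: the active form first gains the z-coefficient 1 while the spare one
  -- drops to `n ⊕ ⊝ v`, and then gains this w-coefficient, reaching `n`, while the spare form loses
  -- its z-coefficient.
  swap⁺ : ∀ v n → Path 2 (active (ι 0) v , spare (ι 1) n) (active (ι 1) n , spare (ι 0) (n ⊕ ⊝ v))
  swap⁺ v n = _ , Step-sym (Gate⇒Step s₁) , _ , Step-sym (Gate⇒Step s₂) , refl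
    where
    s₁ : Gate (active (ι 1) v , spare (ι 1) (n ⊕ ⊝ v)) (active (ι 0) v , spare (ι 1) n)
    s₁ = subst₂ (λ s t → Gate (active s v , spare (ι 1) (n ⊕ ⊝ v)) (active (ι 0) v , spare (ι 1) t))
      (⊕-identityˡ (ι 1)) (solve 2 (λ n v → n :+ :- v :+ v := n) refl n v)
      (gate-shear (ι 0) (ι 1) v (n ⊕ ⊝ v))
    s₂ : Gate (active (ι 1) n , spare (ι 0) (n ⊕ ⊝ v)) (active (ι 1) v , spare (ι 1) (n ⊕ ⊝ v))
    s₂ = subst₂ (λ s t → Gate (active (ι 1) s , spare (ι 0) (n ⊕ ⊝ v)) (active (ι 1) v , spare t (n ⊕ ⊝ v)))
      (solve 2 (λ n v → v :+ (n :+ :- v) := n) refl n v) (⊕-identityˡ (ι 1))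
      (gate-shearᵗ (ι 1) v (n ⊕ ⊝ v) (ι 0))

  -- With z-coefficient -1 in the spare form the shears run forwards, as taking off -1 adds 1.
  swap⁻ : ∀ v n → Path 2 (active (ι 0) v , spare (⊝ ι 1) n) (active (ι 1) (⊝ n) , spare (ι 0) (n ⊕ v))
  swap⁻ v n = _ , Gate⇒Step s₁ , _ , Gate⇒Step s₂ , refl
    where
    s₁ : Gate (active (ι 0) v , spare (⊝ ι 1) n) (active (ι 1) v , spare (⊝ ι 1) (n ⊕ v))
    s₁ = subst (λ s → Gate (active s v , spare (⊝ ι 1) n) (active (ι 1) v , spare (⊝ ι 1) (n ⊕ v)))
      (-‿inverseʳ (ι 1)) (gate-shear (ι 1) (⊝ ι 1) v n)
    s₂ : Gate (active (ι 1) v , spare (⊝ ι 1) (n ⊕ v)) (active (ι 1) (⊝ n) , spare (ι 0) (n ⊕ v))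
    s₂ = subst₂ (λ s t → Gate (active (ι 1) s , spare (⊝ ι 1) (n ⊕ v)) (active (ι 1) (⊝ n) , spare t (n ⊕ v)))
      (solve 2 (λ n v → :- n :+ (n :+ v) := v) refl n v) (⊕-inverseˡ (ι 1))
      (gate-shearᵗ (ι 1) (⊝ n) (n ⊕ v) (⊝ ι 1))

  -- The first components are the coefficient vectors of `φ₁` and `φ₂`, with `k` in place of `a`.
  start finish : F p → Form → State
  start  k P = ⟨ ι 1 , ι 0 , k , ι 1 ⟩ , P
  finish k Q = active (ι 1) k , Q

  Route : ℕ → F p → Set
  Route n k = Σ Form λ P → Σ Form λ Q → Flat (at P) × Flat (at Q) × Path n (start k P) (finish k Q)

  route-κ : ∀ i m → ∣ i ∣ < 2 ^ m → Route (1 ℕ.+ (m ℕ.* 2 ℕ.+ 2)) (κ i)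
  -- The initial idle step changes the x- and y-coefficients from those of `φ₁` to those of `φ₂`.
  route-κ (+ n) m lt with digits m n (ι 1) (ι 1) (ι 0) lt
  ... | v , π = spare (ι 1) (ι 0) , _ , inj₂ refl , inj₁ refl , _ , Gate⇒Step gate-id , _++_ {m ℕ.* 2}
    (subst₂ (λ s t → Path (m ℕ.* 2) (active s (ι 1) , spare (ι 1) (ι 0)) (active (ι 0) v , spare (ι 1) t))
      (solve 1 (λ n → n :* 𝟏 := n) refl (ι n))
      (solve 1 (λ n → 𝟎 :+ n :* 𝟏 := n) refl (ι n)) π)
    (swap⁺ v (ι n))
  -- The digits are those of the absolute value; the sign is carried by `c`.
  route-κ -[1+ n ] m lt with digits m (suc n) (⊝ ι 1) (ι 1) (ι 0) lt
  ... | v , π = spare (⊝ ι 1) (ι 0) , _ , inj₂ refl , inj₁ refl , _ , Gate⇒Step gate-id , _++_ {m ℕ.* 2}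
    (subst₂ (λ s t → Path (m ℕ.* 2) (active s (ι 1) , spare (⊝ ι 1) (ι 0)) (active (ι 0) v , spare (⊝ ι 1) t))
      (solve 1 (λ n → n :* (:- 𝟏) := :- n) refl (ι (suc n)))
      (solve 1 (λ n → 𝟎 :+ n :* 𝟏 := n) refl (ι (suc n))) π)
    (swap⁻ v (ι (suc n)))

  route : ∀ i m → ∣ i ∣ < 2 ^ m → Route (1 ℕ.+ (m ℕ.* 2 ℕ.+ 2)) (⟦_⟧ℤ p i)
  route i m lt = subst (Route (1 ℕ.+ (m ℕ.* 2 ℕ.+ 2))) (sym (⟦⟧ℤ≡κ i)) (route-κ i m lt)

  -- The morphism from the target datum.

  data Role (i : ℤ) {m} (f : Mat p m 4) : Label → Set where
    first  : (∀ r j → f r j ≡ φ (Ψdat p i) zero zero j) → Role i f p₁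
    second : (∀ r j → f r j ≡ φ (Ψdat p i) (suc zero) zero j) → Role i f q₁
    no-z   : ∀ {ℓ} → Spare ℓ → (∀ r → f r 𝐳 ≡ ι 0) → Role i f ℓ
    no-w   : ∀ {ℓ} → Spare ℓ → (∀ r → f r 𝐰 ≡ ι 0) → Role i f ℓ

  module _ {i : ℤ} {m} {f : Mat p m 4} where

    target : ∀ {ℓ} → Role i f ℓ → Fin 4
    target (first _)  = zero
    target (second _) = suc zero
    target (no-z _ _) = 𝐳
    target (no-w _ _) = 𝐰

    weights : ∀ {ℓ} (ρ : Role i f ℓ) → Mat p m (wdim (Ψdat p i) (target ρ))
    weights (first _)  r _                = ι 1
    weights (second _) r _                = ι 1
    weights (no-z _ _) r zero             = f r zero
    weights (no-z _ _) r (suc zero)       = f r (suc zero)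
    weights (no-z _ _) r (suc (suc zero)) = f r 𝐰
    weights (no-w _ _) r zero             = f r zero
    weights (no-w _ _) r (suc zero)       = f r (suc zero)
    weights (no-w _ _) r (suc (suc zero)) = f r 𝐳

    one-dot : ∀ {c : FV p 4} {r} (v : FV p 4) → (∀ j → f r j ≡ c j) → ι 1 ⊗ dot c v ⊕ ι 0 ≡ dot (f r) v
    one-dot {c} {r} v eq = ≡-trans
      (solve 1 (λ d → 𝟏 :* d :+ 𝟎 := d) refl (dot c v))
      (sumF-cong {4} (λ j → cong (_⊗ v j) (sym (eq j))))

    weights-comm : ∀ {ℓ} (ρ : Role i f ℓ) v r →
                   dot (weights ρ r) (_·_ p (φ (Ψdat p i) (target ρ)) v) ≡ dot (f r) v
    weights-comm (first eq)  v r = one-dot v (eq r)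
    weights-comm (second eq) v r = one-dot v (eq r)
    weights-comm (no-z _ eq) v r = ≡-trans
      (solve 7 (λ a b c x y z w →
        a :* (𝟏 :* x :+ (𝟎 :* y :+ (𝟎 :* z :+ (𝟎 :* w :+ 𝟎)))) :+
        (b :* (𝟎 :* x :+ (𝟏 :* y :+ (𝟎 :* z :+ (𝟎 :* w :+ 𝟎)))) :+
        (c :* (𝟎 :* x :+ (𝟎 :* y :+ (𝟎 :* z :+ (𝟏 :* w :+ 𝟎)))) :+ 𝟎))
        := a :* x :+ (b :* y :+ (𝟎 :* z :+ (c :* w :+ 𝟎)))) refl
        (f r zero) (f r (suc zero)) (f r 𝐰) (v zero) (v (suc zero)) (v 𝐳) (v 𝐰))
      (cong (λ k → f r zero ⊗ v zero ⊕ (f r (suc zero) ⊗ v (suc zero) ⊕ (k ⊗ v 𝐳 ⊕ (f r 𝐰 ⊗ v 𝐰 ⊕ ι 0)))) (sym (eq r)))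
    weights-comm (no-w _ eq) v r = ≡-trans
      (solve 7 (λ a b c x y z w →
        a :* (𝟏 :* x :+ (𝟎 :* y :+ (𝟎 :* z :+ (𝟎 :* w :+ 𝟎)))) :+
        (b :* (𝟎 :* x :+ (𝟏 :* y :+ (𝟎 :* z :+ (𝟎 :* w :+ 𝟎)))) :+
        (c :* (𝟎 :* x :+ (𝟎 :* y :+ (𝟏 :* z :+ (𝟎 :* w :+ 𝟎)))) :+ 𝟎))
        := a :* x :+ (b :* y :+ (c :* z :+ (𝟎 :* w :+ 𝟎)))) refl
        (f r zero) (f r (suc zero)) (f r 𝐳) (v zero) (v (suc zero)) (v 𝐳) (v 𝐰))
      (cong (λ k → f r zero ⊗ v zero ⊕ (f r (suc zero) ⊗ v (suc zero) ⊕ (f r 𝐳 ⊗ v 𝐳 ⊕ (k ⊗ v 𝐰 ⊕ ι 0)))) (sym (eq r)))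

    target-p₁ : ∀ {ℓ} (ρ : Role i f ℓ) → ℓ ≡ p₁ → target ρ ≡ zero
    target-p₁ (first _)   _    = refl
    target-p₁ (no-z () _) refl
    target-p₁ (no-w () _) refl

    target-q₁ : ∀ {ℓ} (ρ : Role i f ℓ) → ℓ ≡ q₁ → target ρ ≡ suc zero
    target-q₁ (second _)  _    = refl
    target-q₁ (no-z () _) refl
    target-q₁ (no-w () _) refl

    target-zero : ∀ {ℓ} (ρ : Role i f ℓ) → target ρ ≡ zero → ℓ ≡ p₁
    target-zero (first _) _ = refl

    target-one : ∀ {ℓ} (ρ : Role i f ℓ) → target ρ ≡ suc zero → ℓ ≡ q₁
    target-one (second _) _ = refl

    subst-one : ∀ {n} (1≡n : 1 ≡ n) (u : FV p 1) r → ι 1 ⊗ u zero ⊕ ι 0 ≡ subst (FV p) 1≡n u r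
    subst-one refl u zero = solve 1 (λ d → 𝟏 :* d :+ 𝟎 := d) refl (u zero)

    weights-id : ∀ {ℓ} (ρ : Role i f ℓ) → m ≡ 1 → ℓ ≡ p₁ ⊎ ℓ ≡ q₁ →
                 Σ (wdim (Ψdat p i) (target ρ) ≡ m) λ eq → ∀ u r → dot (weights ρ r) u ≡ subst (FV p) eq u r
    weights-id (first _)   m≡1 _ = sym m≡1 , subst-one (sym m≡1)
    weights-id (second _)  m≡1 _ = sym m≡1 , subst-one (sym m≡1)
    weights-id (no-z () _) m≡1 (inj₁ refl)
    weights-id (no-z () _) m≡1 (inj₂ refl)
    weights-id (no-w () _) m≡1 (inj₁ refl)
    weights-id (no-w () _) m≡1 (inj₂ refl)

    spare-role : ∀ {ℓ} → Spare ℓ → Axis f → Role i f ℓ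
    spare-role s (inj₁ z) = no-z s z
    spare-role s (inj₂ w) = no-w s w

    role : ∀ ℓ {P Q} → Flat (at P) → Flat (at Q) →
           Fits ℓ (start (⟦_⟧ℤ p i) P) (finish (⟦_⟧ℤ p i) Q) f → Role i f ℓ
    -- The two coefficient vectors agree by computation only once the column is known.
    role p₁   _ _ h = first λ where
      r zero                   → h r zero
      r (suc zero)             → h r (suc zero)
      r (suc (suc zero))       → h r 𝐳
      r (suc (suc (suc zero))) → h r 𝐰
    role q₁   _ _ h = second λ where
      r zero                   → h r zero
      r (suc zero)             → h r (suc zero)
      r (suc (suc zero))       → h r 𝐳
      r (suc (suc (suc zero))) → h r 𝐰
    role p₂   P _ h = spare-role p₂ (Flat⇒Axis h P)
    role q₂   _ Q h = spare-role q₂ (Flat⇒Axis h Q)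
    role side _ _ h = spare-role side h

  module _ {n} (L : Ladder n) (i : ℤ) (c : Config (joined L))
           (ρ : ∀ k → Role i (form c k) (joined-label L k)) where

    Ψ = Ψdat p i

    Θ : Morphism p Ψ (joined L)
    Θ = record
      { α    = λ k → just (target (ρ k))
      ; θ    = mat c
      -- Each defining functional kills every column of the matrix, hence the image of every vector.
      ; θ-V  = λ v _ x → ≡-trans (sym (dot-comb (con (joined L) x) (mat c) v))
                 (≡-trans (sumF-cong {4} (λ j → cong (_⊗ v j) (sat c x j))) (dot-zeroˡ v))
      ; σ    = λ k → weights (ρ k)
      ; comm = λ k v _ r → ≡-trans (weights-comm (ρ k) v r) (dot-comb (φ (joined L) k r) (mat c) v)
      }

    respects : ∀ k → joined-label L k ≡ p₁ ⊎ joined-label L k ≡ q₁ →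
               (∀ k′ → target (ρ k′) ≡ target (ρ k) → k′ ≡ k) → Respects p Θ k
    respects k end unique = target (ρ k) , refl , (λ k′ eq → unique k′ (just-injective eq)) ,
      weights-id (ρ k) (wdim≡1 (double L) k) end

    left-target : target (ρ (left-end L)) ≡ zero
    left-target = target-p₁ (ρ (left-end L)) (label-end (double L))

    right-label : joined-label L (right-end L) ≡ q₁
    right-label = cong (relabel true) (label-end L)

    right-target : target (ρ (right-end L)) ≡ suc zero
    right-target = target-q₁ (ρ (right-end L)) right-label

    ends : PMap (Fin 4) (Idx (joined L))
    ends zero          = just (left-end L , false)
    ends (suc zero)    = just (right-end L , false)
    ends (suc (suc _)) = nothing

    -- The indices 3 and 4 of Ψ cannot be respected, since they carry F³ rather than F.
    wide : ∀ {j} k → wdim Ψ (suc (suc j)) ≢ 1 → Respects p Θ k → target (ρ k) ≢ suc (suc j)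
    wide k ≢1 (_ , _ , _ , eq , _) t = ≢1 (≡-trans (cong (wdim Ψ) (sym t)) (≡-trans eq (wdim≡1 (double L) k)))

    wdim-wide : ∀ j → wdim Ψ (suc (suc j)) ≢ 1
    wdim-wide zero       ()
    wdim-wide (suc zero) ()

    ends-respected : RespectMap p Θ ends
    ends-respected zero =
      (λ { _ _ refl → refl , respects (left-end L) (inj₁ (label-end (double L)))
             (λ k eq → left-end-unique L k (target-zero (ρ k) (≡-trans eq left-target)))
         , cong just left-target }) ,
      λ k _ eq → cong (λ k → just (k , false)) (sym (left-end-unique L k (target-zero (ρ k) (just-injective eq))))
    ends-respected (suc zero) =
      (λ { _ _ refl → refl , respects (right-end L) (inj₂ right-label)
             (λ k eq → right-end-unique L k (target-one (ρ k) (≡-trans eq right-target)))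
         , cong just right-target }) ,
      λ k _ eq → cong (λ k → just (k , false)) (sym (right-end-unique L k (target-one (ρ k) (just-injective eq))))
    ends-respected (suc (suc j)) = (λ _ _ ()) , λ k resp eq → contradiction (just-injective eq) (wide k (wdim-wide j) resp)

    derives-Ψ : Derives p (U3 p) (suc n) Ψ γΨ
    derives-Ψ = weaken (ℕ.≤-reflexive (ℕ.+-identityʳ (suc n))) restricts
      (trans (joined-derives L) (morph Θ (4 , (λ k → k) , λ k → k , refl) ends ends-respected))
      where
      restricts : Restriction γΨ (composeγ (joined-γ L) ends)
      restricts zero       _ refl rewrite joined-γ-end L false = refl
      restricts (suc zero) _ refl rewrite joined-γ-end L true  = refl
      restricts (suc (suc zero)) _ ()
      restricts (suc (suc (suc zero))) _ ()

  -- The route is padded with idle steps to length `2 ^ s` and laid on `ladder (suc s)`. Its datum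
  -- is `joined (ladder s)`, reached from the cube by `suc (suc s)` joins; the final morphism costs
  -- none.
  U3-derives-Ψ : ∀ i → Derives p (U3 p) (Mbound i) (Ψdat p i) γΨ
  U3-derives-Ψ i with Mbound-spec i
  ... | s , m , cost , i<2^m , steps with route i m i<2^m
  ...   | P₂ , Q₂ , flatP , flatQ , π with Path⇒Links s (Path-pad steps π)
  ...     | c , fits = weaken cost (λ _ _ eq → eq) (derives-Ψ (ladder s) i c
            (λ k → role (joined-label (ladder s) k) flatP flatQ (fits k)))

theorem3p12 : (p : ℕ) .{{_ : NonZero p}} → Prime p → 2 < p → (a : ℤ) →
    Derives p (U3 p) (Mbound a) (Ψdat p a) γΨ
theorem3p12 p _ _ = Proof.U3-derives-Ψ p
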